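{- For every integer $n\ge 4$, player 1 has a winning strategy in the transversal $n$-game; that is, with optimal play by both players, the transversal $n$-game is a win for player 1.
   Context: A transversal of an $n\times n$ grid is a set of $n$ cells no two of which lie in the same row or the same column. The transversal $n$-game is played on an $n\times n$ grid by two players who alternate moves, player 1 moving first. On each move, the player to move claims one currently unoccupied cell (player 1 marks it $X$, player 2 marks it $O$). The first player (if any) to have claimed all $n$ cells of some transversal wins. If the grid becomes completely filled and neither player has claimed a transversal, the game is a draw. -}

module Defs where

open import Data.Fin.Base using (Fin)
open import Data.List.Base using (List; []; _∷_)
open import Data.List.Membership.Propositional using (_∈_; _∉_)
open import Data.Nat.Base using (ℕ)
open import Data.Product.Base using (_×_; proj₁; proj₂; Σ-syntax)
open import Function.Base using (_∘_)
open import Function.Definitions using (Injective)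
open import Relation.Binary.PropositionalEquality.Core using (_≡_)
open import Relation.Nullary.Negation.Core using (¬_)

-- (row , column)
Cell : ℕ → Set
Cell n = Fin n × Fin n

-- The set of n cells is given by an enumeration; distinctness of the cells
-- follows from either field.
record Transversal (n : ℕ) : Set where
  field
    cell             : Fin n → Cell n
    distinct-rows    : Injective _≡_ _≡_ (proj₁ ∘ cell)
    distinct-columns : Injective _≡_ _≡_ (proj₂ ∘ cell)

data Player : Set where
  player₁ player₂ : Player

opponent : Player → Player
opponent player₁ = player₂
opponent player₂ = player₁

-- The cells claimed so far by the two players in alternation, most recent
-- move first.
History : ℕ → Set
History n = List (Cell n)

toMove : {n : ℕ} → History n → Player
toMove []      = player₁
toMove (_ ∷ h) = opponent (toMove h)

data Claimed {n : ℕ} (p : Player) (c : Cell n) : History n → Set where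
  now     : {h : History n} → toMove h ≡ p → Claimed p c (c ∷ h)
  earlier : {d : Cell n} {h : History n} → Claimed p c h → Claimed p c (d ∷ h)

HasTransversal : {n : ℕ} → Player → History n → Set
HasTransversal {n} p h =
  Σ[ T ∈ Transversal n ] ((i : Fin n) → Claimed p (Transversal.cell T i) h)

Full : {n : ℕ} → History n → Set
Full {n} h = (c : Cell n) → c ∈ h

Move : {n : ℕ} → History n → Set
Move {n} h = Σ[ c ∈ Cell n ] c ∉ h

-- The hypothesis is irrelevant so that the move chosen depends on the history
-- alone. The same type serves both players: only the values at histories where
-- the player in question is to move are ever used.
Strategy : ℕ → Set
Strategy n = (h : History n) → .(¬ Full h) → Move h

data Result : Set where
  win  : Player → Result
  draw : Result

strategyOf : {n : ℕ} (σ τ : Strategy n) → Player → Strategy n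
strategyOf σ τ player₁ = σ
strategyOf σ τ player₂ = τ

-- Outcome σ τ h r: if player 1 follows σ and player 2 follows τ, the play
-- continuing from h ends with result r. Play stops at the first completed
-- transversal, so "the first player to have claimed one" is the only player
-- to have claimed one when play stops.
data Outcome {n : ℕ} (σ τ : Strategy n) : History n → Result → Set where
  won      : {h : History n} {p : Player} →
             HasTransversal p h → Outcome σ τ h (win p)
  drawn    : {h : History n} →
             Full h → ((p : Player) → ¬ HasTransversal p h) →
             Outcome σ τ h draw
  continue : {h : History n} {r : Result} →
             (notFull : ¬ Full h) → ((p : Player) → ¬ HasTransversal p h) →
             Outcome σ τ
               (proj₁ (strategyOf σ τ (toMove h) h notFull) ∷ h) r →
             Outcome σ τ h r

IsWinningForPlayer₁ : {n : ℕ} → Strategy n → Set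
IsWinningForPlayer₁ {n} σ = (τ : Strategy n) → Outcome σ τ [] (win player₁)

{-# OPTIONS --safe #-}
module Submission where

-- Player 1 first builds a partial transversal, always playing in the row of
-- player 2's last mark if that mark lies in the remaining board, so that player 2
-- has at most one mark in the board of size 2 that remains after n - 2 moves. A
-- further move x leaves one missing cell y = (r , c), which player 2 must occupy.
-- Player 1 then exchanges cells of the transversal: a cell of column c forces
-- another answer in row r, and a cell of row r finally makes two threats at once.
-- Having three marks in one row (or an equivalent waste), player 2 cannot complete
-- a transversal in time; a counting argument on the n - 2 free marks of player 2
-- shows that x can be chosen so that the cells needed are free. Positions are
-- relabelled so that player 1's transversal is always the diagonal.

open import Defs
open import Data.Bool.Base using (Bool; true; false; not)
open import Data.Bool.Properties using (not-¬)
open import Data.Empty using (⊥)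
open import Data.Fin.Base using (Fin; zero; suc; toℕ; fromℕ<; punchOut)
open import Data.Fin.Permutation.Components using (transpose)
open import Data.Fin.Properties as Fin
  using (_≟_; any?; all?; injective⇒≤; toℕ-injective; toℕ<n; toℕ-fromℕ<)
open import Data.List.Base using (List; []; _∷_; length; map)
open import Data.List.Membership.Propositional using (_∈_; _∉_)
open import Data.List.Membership.Propositional.Properties using (∈-map⁺; ∈-map⁻)
import Data.List.Membership.DecPropositional as DecMembership
import Data.List.Membership.Setoid.Properties as SetoidMembership
open import Data.List.Properties using (length-map; map-∘)
open import Data.List.Relation.Unary.Any using (here; there)
open import Data.Maybe.Base using (Maybe; just; nothing)
open import Data.Nat.Base using (ℕ; _≥_; zero; suc; _+_; _≤_; _<_; z≤n; s≤s)
open import Data.Nat.Properties as ℕ using (≤-refl; ≤-trans; ≤-reflexive; n≮n)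
open import Data.Product.Base
  using (Σ-syntax; ∃; ∃-syntax; _×_; _,_; proj₁; proj₂; swap)
open import Data.Product.Properties using (≡-dec)
open import Data.Sum.Base using (_⊎_; inj₁; inj₂; [_,_]′)
open import Data.Vec.Base as Vec using (Vec; lookup; tabulate)
open import Data.Vec.Properties using (lookup∘tabulate)
open import Function.Base using (_∘_; id)
open import Function.Definitions using (Injective)
open import Relation.Binary.Definitions using (DecidableEquality)
open import Relation.Binary.PropositionalEquality
  using (_≡_; _≢_; refl; sym; trans; cong; cong₂; subst; subst₂; setoid)
open import Relation.Nullary using (¬_; Dec; yes; no; contradiction)
open import Relation.Nullary.Decidable using (map′; ¬?; _×-dec_; _→-dec_; decidable-stable)
open import Relation.Unary using (Decidable)

open Transversal

-- Pigeonhole arguments and transpositions on finite sets.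

_≟ᶜ_ : ∀ {n} → DecidableEquality (Cell n)
_≟ᶜ_ = ≡-dec _≟_ _≟_

_∈?_ : ∀ {n} (c : Cell n) L → Dec (c ∈ L)
_∈?_ = DecMembership._∈?_ _≟ᶜ_

injective-∈⇒≤ : ∀ {A : Set} {n} {f : Fin n → A} {xs} →
                Injective _≡_ _≡_ f → (∀ i → f i ∈ xs) → n ≤ length xs
injective-∈⇒≤ f-inj f∈ = injective⇒≤ λ {i} {j} eq →
  f-inj (SetoidMembership.index-injective (setoid _) (f∈ i) (f∈ j) eq)

∃∉ : ∀ {n} (xs : List (Fin n)) → length xs < n → ∃[ i ] i ∉ xs
∃∉ xs short with any? (λ i → ¬? (DecMembership._∈?_ _≟_ i xs))
... | yes found = found
... | no none   = contradiction
  (injective-∈⇒≤ id λ i → decidable-stable (DecMembership._∈?_ _≟_ i xs) (λ i∉ → none (i , i∉)))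
  (ℕ.<⇒≱ short)

-- If `v` were missed, punching it out would inject `Fin (suc n)` into `Fin n`. Applied to row and
-- column indices, it makes a transversal meet every row and column.
injective⇒hits : ∀ {n} {f : Fin n → Fin n} → Injective _≡_ _≡_ f → ∀ v → ∃[ i ] f i ≡ v
injective⇒hits {suc n} {f} f-inj v with any? (λ i → f i ≟ v)
... | yes hit  = hit
... | no never = contradiction
  (injective⇒≤ {f = λ i → punchOut (v≢f i)} λ {i} {j} → f-inj ∘ Fin.punchOut-injective (v≢f i) (v≢f j))
  (n≮n n)
  where
  v≢f : ∀ i → v ≢ f i
  v≢f i eq = never (i , sym eq)

transpose-first : ∀ {n} (i j : Fin n) → transpose i j i ≡ j
transpose-first i j with i ≟ i
... | yes _  = refl
... | no i≢i = contradiction refl i≢i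

transpose-second : ∀ {n} (i j : Fin n) → transpose i j j ≡ i
transpose-second i j with j ≟ i
... | yes j≡i = j≡i
... | no _ with j ≟ j
...   | yes _  = refl
...   | no j≢j = contradiction refl j≢j

transpose-other : ∀ {n} {i j k : Fin n} → k ≢ i → k ≢ j → transpose i j k ≡ k
transpose-other {i = i} {j} {k} k≢i k≢j with k ≟ i
... | yes k≡i = contradiction k≡i k≢i
... | no _ with k ≟ j
...   | yes k≡j = contradiction k≡j k≢j
...   | no _    = refl

-- For transversals obtained by an exchange: only the two new cells have to be named, the others are
-- inherited.
transpose-elim : ∀ {n} (C : Fin n → Fin n → Set) {i j : Fin n} → C i j → C j i →
                 (∀ k → k ≢ i → k ≢ j → C k k) → ∀ k → C k (transpose i j k)
transpose-elim C {i} {j} cij cji other k with k ≟ i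
... | yes refl = cij
... | no k≢i with k ≟ j
...   | yes refl = cji
...   | no k≢j   = other k k≢i k≢j

transpose-involutive : ∀ {n} (i j k : Fin n) → transpose i j (transpose i j k) ≡ k
transpose-involutive i j = transpose-elim (λ k t → transpose i j t ≡ k)
  (transpose-second i j) (transpose-first i j) (λ _ → transpose-other)

involutive⇒injective : ∀ {A : Set} {f : A → A} → (∀ x → f (f x) ≡ x) → Injective _≡_ _≡_ f
involutive⇒injective {f = f} inv eq = trans (sym (inv _)) (trans (cong f eq) (inv _))

transpose-injective : ∀ {n} (i j : Fin n) → Injective _≡_ _≡_ (transpose i j)
transpose-injective i j = involutive⇒injective (transpose-involutive i j)

-- Deciding whether a set of cells contains a transversal; winning positions.

TransversalIn : ∀ {n} → List (Cell n) → Set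
TransversalIn {n} L = Σ[ t ∈ Transversal n ] (∀ i → cell t i ∈ L)

∃Vec? : ∀ {A : Set} → (∀ {P : A → Set} → Decidable P → Dec (∃ P)) →
        ∀ m {P : Vec A m → Set} → Decidable P → Dec (∃ P)
∃Vec? search zero    P? = map′ (Vec.[] ,_) (λ { (Vec.[] , p) → p }) (P? Vec.[])
∃Vec? search (suc m) P? = map′
  (λ { (x , xs , p) → x Vec.∷ xs , p }) (λ { (x Vec.∷ xs , p) → x , xs , p })
  (search λ x → ∃Vec? search m λ xs → P? (x Vec.∷ xs))

∃Cell? : ∀ {n} {P : Cell n → Set} → Decidable P → Dec (∃ P)
∃Cell? P? = map′ (λ { (r , c , p) → (r , c) , p }) (λ { ((r , c) , p) → r , c , p })
  (any? λ r → any? λ c → P? (r , c))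

injective? : ∀ {m n} (f : Fin m → Fin n) → Dec (Injective _≡_ _≡_ f)
injective? f = map′ (λ g {i} {j} → g i j) (λ g i j → g {i} {j})
  (all? λ i → all? λ j → (f i ≟ f j) →-dec (i ≟ j))

-- The enumeration of a transversal is searched for as the vector of its values; injectivity and
-- membership depend on these values alone.
transversalIn? : ∀ {n} (L : List (Cell n)) → Dec (TransversalIn L)
transversalIn? {n} L = map′ to from (∃Vec? ∃Cell? n λ v →
  injective? (proj₁ ∘ lookup v) ×-dec injective? (proj₂ ∘ lookup v) ×-dec
  all? λ i → lookup v i ∈? L)
  where
  Listed = ∃[ v ] Injective _≡_ _≡_ (proj₁ ∘ lookup {n = n} v) ×
                  Injective _≡_ _≡_ (proj₂ ∘ lookup v) × (∀ i → lookup v i ∈ L)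

  to : Listed → TransversalIn L
  to (v , rows , columns , v∈) =
    record { cell = lookup v ; distinct-rows = rows ; distinct-columns = columns } , v∈

  from : TransversalIn L → Listed
  from (t , t∈) =
      tabulate (cell t)
    , (λ {i} {j} e → distinct-rows t
        (trans (cong proj₁ (sym (eq i))) (trans e (cong proj₁ (eq j)))))
    , (λ {i} {j} e → distinct-columns t
        (trans (cong proj₂ (sym (eq i))) (trans e (cong proj₂ (eq j)))))
    , λ i → subst (_∈ L) (sym (eq i)) (t∈ i)
    where eq = lookup∘tabulate (cell t)

-- Winning positions: P and Q list the cells claimed by player 1 and player 2;
-- player 1 is to move in Win P Q, player 2 in Won P Q.
mutual
  data Win {n} (P Q : List (Cell n)) : Set where
    move : ∀ c → c ∉ P → c ∉ Q → Won (c ∷ P) Q → Win P Q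

  data Won {n} (P Q : List (Cell n)) : Set where
    done  : TransversalIn P → Won P Q
    reply : (∃[ c ] c ∉ P × c ∉ Q) →
            (∀ d → d ∉ P → d ∉ Q → ¬ TransversalIn (d ∷ Q)) →
            (∀ d → d ∉ P → d ∉ Q → Win P (d ∷ Q)) → Won P Q

-- From winning trees to strategies on histories.

module _ {n : ℕ} where

  -- Histories grow by whole rounds, so player 1 is always to move here; the state in the middle of
  -- a round is treated by `claims₁′` and `claims₂′`.
  data Position : History n → List (Cell n) → List (Cell n) → Set where
    []  : Position [] [] []
    _∷_ : ∀ {h P Q c d} → (c ∉ P × c ∉ Q) × (d ∉ c ∷ P × d ∉ Q) →
          Position h P Q → Position (d ∷ c ∷ h) (c ∷ P) (d ∷ Q)

  toMove-position : ∀ {h : History n} {P Q} → Position h P Q → toMove h ≡ player₁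
  toMove-position []                              = refl
  toMove-position (_ ∷ pos) rewrite toMove-position pos = refl

  Claims : Player → History n → List (Cell n) → Set
  Claims p h L = (∀ {c} → Claimed p c h → c ∈ L) × (∀ {c} → c ∈ L → Claimed p c h)

  claims-mover : ∀ {p h L} c → toMove h ≡ p → Claims p h L → Claims p (c ∷ h) (c ∷ L)
  claims-mover c eq (to , from) =
      (λ { (now _) → here refl ; (earlier x) → there (to x) })
    , (λ { (here refl) → now eq ; (there x) → earlier (from x) })

  claims-other : ∀ {p h L} c → toMove h ≢ p → Claims p h L → Claims p (c ∷ h) L
  claims-other c neq (to , from) =
    (λ { (now eq) → contradiction eq neq ; (earlier x) → to x }) , earlier ∘ from

  mutual
    claims₁ : ∀ {h P Q} → Position h P Q → Claims player₁ h P
    claims₁ []        = (λ ()) , (λ ())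
    claims₁ (_ ∷ pos) = claims-other _ (λ eq → neq (trans (sym second) eq)) (claims₁′ _ pos)
      where
      second = cong opponent (toMove-position pos)
      neq : player₂ ≢ player₁
      neq ()

    claims₁′ : ∀ {h P Q} c → Position h P Q → Claims player₁ (c ∷ h) (c ∷ P)
    claims₁′ c pos = claims-mover c (toMove-position pos) (claims₁ pos)

  mutual
    claims₂ : ∀ {h P Q} → Position h P Q → Claims player₂ h Q
    claims₂ []        = (λ ()) , (λ ())
    claims₂ (_ ∷ pos) = claims-mover _ (cong opponent (toMove-position pos)) (claims₂′ _ pos)

    claims₂′ : ∀ {h P Q} c → Position h P Q → Claims player₂ (c ∷ h) Q
    claims₂′ c pos = claims-other c (λ eq → neq (trans (sym (toMove-position pos)) eq)) (claims₂ pos)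
      where
      neq : player₁ ≢ player₂
      neq ()

  ∈-position : ∀ {h P Q c} → Position h P Q → c ∈ h → c ∈ P ⊎ c ∈ Q
  ∈-position (_ ∷ pos) (here eq)           = inj₂ (here eq)
  ∈-position (_ ∷ pos) (there (here eq))   = inj₁ (here eq)
  ∈-position (_ ∷ pos) (there (there c∈h)) with ∈-position pos c∈h
  ... | inj₁ c∈P = inj₁ (there c∈P)
  ... | inj₂ c∈Q = inj₂ (there c∈Q)

  position-∈ : ∀ {h P Q c} → Position h P Q → c ∈ P ⊎ c ∈ Q → c ∈ h
  position-∈ (_ ∷ pos) (inj₁ (here eq))  = there (here eq)
  position-∈ (_ ∷ pos) (inj₁ (there x))  = there (there (position-∈ pos (inj₁ x)))
  position-∈ (_ ∷ pos) (inj₂ (here eq))  = here eq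
  position-∈ (_ ∷ pos) (inj₂ (there x))  = there (there (position-∈ pos (inj₂ x)))

  position-∉ : ∀ {h P Q c d} → Position h P Q → c ∉ P → c ∉ Q → c ≢ d → c ∉ d ∷ h
  position-∉ pos c∉P c∉Q c≢d (here eq)    = c≢d eq
  position-∉ pos c∉P c∉Q c≢d (there c∈h) = [ c∉P , c∉Q ]′ (∈-position pos c∈h)

  transversal⁺ : ∀ {p h L} → Claims p h L → TransversalIn L → HasTransversal p h
  transversal⁺ (_ , from) (t , t∈) = t , from ∘ t∈

  transversal⁻ : ∀ {p h L} → Claims p h L → HasTransversal p h → TransversalIn L
  transversal⁻ (to , _) (t , claimed) = t , to ∘ claimed

  -- A default for histories outside the tree. The irrelevant hypothesis serves only to refute a
  -- failed search, through an irrelevant `⊥`.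
  anyMove : (h : History n) → .(¬ Full h) → Move h
  anyMove h notFull with ∃Cell? (λ c → ¬? (c ∈? h))
  ... | yes m  = m
  ... | no none = absurd (notFull λ c → decidable-stable (c ∈? h) λ c∉ → none (c , c∉))
    where
    absurd : .⊥ → Move h
    absurd ()

  module FromWin (start : Win {n} [] []) where

    Located : History n → Set
    Located h = ∃[ P ] ∃[ Q ] Position h P Q × Win P Q

    advance : ∀ c d {h} → Located h → Maybe (Located (d ∷ c ∷ h))
    advance c d (P , Q , pos , move c′ c∉P c∉Q (done _)) = nothing
    advance c d (P , Q , pos , move c′ c∉P c∉Q (reply _ _ next))
      with c ≟ᶜ c′ | d ∈? (c′ ∷ P) | d ∈? Q
    ... | yes refl | no d∉P | no d∉Q =
      just (_ , _ , ((c∉P , c∉Q) , (d∉P , d∉Q)) ∷ pos , next d d∉P d∉Q)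
    ... | _ | _ | _ = nothing

    -- A strategy sees only the history, so the current node of the tree is recovered by replaying
    -- the history from `start`, a round at a time. The value `nothing` marks histories that left
    -- the tree, passed its end or stop in the middle of a round.
    locate : (h : History n) → Maybe (Located h)
    locate []      = just ([] , [] , [] , start)
    locate (_ ∷ []) = nothing
    locate (d ∷ c ∷ h) with locate h
    ... | just l  = advance c d l
    ... | nothing = nothing

    chosen : ∀ {h} → Located h → Move h
    chosen (P , Q , pos , move c c∉P c∉Q _) =
      c , λ c∈h → [ c∉P , c∉Q ]′ (∈-position pos c∈h)

    σ : Strategy n
    σ h notFull with locate h
    ... | just l  = chosen l
    ... | nothing = anyMove h notFull

    σ-located : ∀ {h l} → locate h ≡ just l → .(nf : ¬ Full h) → σ h nf ≡ chosen l
    σ-located {h} eq nf rewrite eq = refl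

    locate-next : ∀ {c d h l} → locate h ≡ just l → locate (d ∷ c ∷ h) ≡ advance c d l
    locate-next eq rewrite eq = refl

    -- `advance` stores the non-membership proofs found by its own tests, which may differ from the
    -- given ones; hence the existential quantifiers.
    advance-next : ∀ {h P Q c d} (pos : Position h P Q) c∉P c∉Q free safe next →
                   d ∉ c ∷ P → d ∉ Q → ∃[ p ] ∃[ q ] ∃[ pos′ ]
                   advance c d (P , Q , pos , move c c∉P c∉Q (reply free safe next)) ≡
                   just (c ∷ P , d ∷ Q , pos′ , next d p q)
    advance-next {P = P} {Q} {c} {d} pos _ _ _ _ _ d∉P d∉Q
      with c ≟ᶜ c | d ∈? (c ∷ P) | d ∈? Q
    ... | yes refl | no p     | no q     = p , q , _ , refl
    ... | no c≢c   | _        | _        = contradiction refl c≢c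
    ... | yes refl | yes d∈P  | _        = contradiction d∈P d∉P
    ... | yes refl | no _     | yes d∈Q  = contradiction d∈Q d∉Q

    module _ (τ : Strategy n) where

      -- With the mover abstracted to `p`, `strategyOf` computes as soon as `p` is concrete.
      follow : ∀ {h p r} → toMove h ≡ p → (nf : ¬ Full h) → (∀ p → ¬ HasTransversal p h) →
               Outcome σ τ (proj₁ (strategyOf σ τ p h nf) ∷ h) r → Outcome σ τ h r
      follow refl = continue

      neither : ∀ {h P Q} → Claims player₁ h P → Claims player₂ h Q →
                ¬ TransversalIn P → ¬ TransversalIn Q → ∀ p → ¬ HasTransversal p h
      neither claims _ ¬t₁ ¬t₂ player₁ = ¬t₁ ∘ transversal⁻ claims
      neither _ claims ¬t₁ ¬t₂ player₂ = ¬t₂ ∘ transversal⁻ claims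

      -- Induction on the tree. The equation for `locate` ties the history to the node from which
      -- `σ` moves; that `Q` holds no transversal comes from the `safe` part of the preceding round.
      play : ∀ {h P Q} (pos : Position h P Q) (w : Win P Q) → locate h ≡ just (P , Q , pos , w) →
             ¬ TransversalIn Q → Outcome σ τ h (win player₁)
      play {h} {P} {Q} pos w@(move c c∉P c∉Q k) located ¬t₂
        with transversalIn? P
      ... | yes t  = won (transversal⁺ (claims₁ pos) t)
      ... | no ¬t₁ = follow (toMove-position pos) notFull
          (neither (claims₁ pos) (claims₂ pos) ¬t₁ ¬t₂)
          (subst (λ m → Outcome σ τ (proj₁ m ∷ h) (win player₁)) (sym (σ-located located notFull))
            (answer k refl))
        where
        notFull : ¬ Full h
        notFull full = proj₂ (chosen (P , Q , pos , w)) (full c)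

        -- Splitting `k′` and then matching the equation refines `k` itself, so that `located` still
        -- speaks of the same node.
        answer : (k′ : Won (c ∷ P) Q) → k ≡ k′ → Outcome σ τ (c ∷ h) (win player₁)
        answer (done t) eq = won (transversal⁺ (claims₁′ c pos) t)
        answer (reply (e , e∉P , e∉Q) safe next) refl with transversalIn? (c ∷ P)
        ... | yes t  = won (transversal⁺ (claims₁′ c pos) t)
        ... | no ¬t₁ = follow (cong opponent (toMove-position pos)) notFull′
            (neither (claims₁′ c pos) (claims₂′ c pos) ¬t₁ ¬t₂)
            (proceed (τ (c ∷ h) notFull′))
          where
          notFull′ : ¬ Full (c ∷ h)
          notFull′ full = position-∉ pos (e∉P ∘ there) e∉Q (e∉P ∘ here) (full e)

          proceed : (m : Move (c ∷ h)) → Outcome σ τ (proj₁ m ∷ c ∷ h) (win player₁)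
          proceed (d , d∉) = continued
            where
            d∉cP : d ∉ c ∷ P
            d∉cP (here eq)   = d∉ (here eq)
            d∉cP (there d∈P) = d∉ (there (position-∈ pos (inj₁ d∈P)))

            d∉Q : d ∉ Q
            d∉Q d∈Q = d∉ (there (position-∈ pos (inj₂ d∈Q)))

            continued : Outcome σ τ (d ∷ c ∷ h) (win player₁)
            continued with advance-next pos c∉P c∉Q (e , e∉P , e∉Q) safe next d∉cP d∉Q
            ... | p , q , pos′ , eq = play pos′ (next d p q) (trans (locate-next located) eq) (safe d p q)

    -- The index excludes the empty grid, on which the empty list already contains a transversal.
    wins : Fin n → IsWinningForPlayer₁ σ
    wins i τ = play τ [] start refl (λ { (_ , t∈) → ¬∈[] (t∈ i) })
      where
      ¬∈[] : ∀ {c : Cell n} → c ∉ []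
      ¬∈[] ()

-- Relabelling positions by symmetries of the grid.

record Symmetry (n : ℕ) : Set where
  field
    act        : Cell n → Cell n
    involutive : ∀ c → act (act c) ≡ c
    preserves  : (t : Transversal n) → Σ[ t′ ∈ Transversal n ] (∀ i → cell t′ i ≡ act (cell t i))

module Relabelling {n} (φ : Symmetry n) where
  open Symmetry φ

  -- Order and repetition in the lists are ignored, so a list can correspond to itself. As `act` is
  -- an involution, it serves in both directions.
  _⟷_ : List (Cell n) → List (Cell n) → Set
  P ⟷ P′ = (∀ {c} → c ∈ P → act c ∈ P′) × (∀ {c} → c ∈ P′ → act c ∈ P)

  map-⟷ : ∀ P → P ⟷ map act P
  map-⟷ P = ∈-map⁺ act , λ c∈ → let d , d∈P , eq = ∈-map⁻ act c∈ in
    subst (_∈ P) (sym (trans (cong act eq) (involutive d))) d∈P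

  ∷-⟷ : ∀ {P P′} c → P ⟷ P′ → (act c ∷ P) ⟷ (c ∷ P′)
  ∷-⟷ c (to , from) =
      (λ { (here refl) → here (involutive c) ; (there x) → there (to x) })
    , (λ { (here refl) → here refl ; (there x) → there (from x) })

  ⟷-∷ : ∀ {P P′} c → P ⟷ P′ → (c ∷ P) ⟷ (act c ∷ P′)
  ⟷-∷ c (to , from) =
      (λ { (here refl) → here refl ; (there x) → there (to x) })
    , (λ { (here refl) → here (involutive c) ; (there x) → there (from x) })

  ⟷-∉ : ∀ {P P′ c} → P ⟷ P′ → c ∉ P′ → act c ∉ P
  ⟷-∉ (to , _) c∉ ac∈ = c∉ (subst (_∈ _) (involutive _) (to ac∈))

  ∉-⟷ : ∀ {P P′ c} → P ⟷ P′ → c ∉ P → act c ∉ P′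
  ∉-⟷ (_ , from) c∉ ac∈ = c∉ (subst (_∈ _) (involutive _) (from ac∈))

  transversal⇒ : ∀ {P P′} → P ⟷ P′ → TransversalIn P → TransversalIn P′
  transversal⇒ (to , _) (t , t∈) = let t′ , eq = preserves t in
    t′ , λ i → subst (_∈ _) (sym (eq i)) (to (t∈ i))

  transversal⇐ : ∀ {P P′} → P ⟷ P′ → TransversalIn P′ → TransversalIn P
  transversal⇐ (_ , from) (t , t∈) = let t′ , eq = preserves t in
    t′ , λ i → subst (_∈ _) (sym (eq i)) (from (t∈ i))

  mutual
    -- Player 1 plays the image of the move in the given tree and reads player 2's answer through
    -- the same map.
    relabel-win : ∀ {P P′ Q Q′} → P ⟷ P′ → Q ⟷ Q′ → Win P′ Q′ → Win P Q
    relabel-win p q (move c c∉P c∉Q k) = move (act c) (⟷-∉ p c∉P) (⟷-∉ q c∉Q) (relabel-won (∷-⟷ c p) q k)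

    relabel-won : ∀ {P P′ Q Q′} → P ⟷ P′ → Q ⟷ Q′ → Won P′ Q′ → Won P Q
    relabel-won p q (done t) = done (transversal⇐ p t)
    relabel-won p q (reply (c , c∉P , c∉Q) safe next) =
      reply (act c , ⟷-∉ p c∉P , ⟷-∉ q c∉Q)
        (λ d d∉P d∉Q → safe (act d) (∉-⟷ p d∉P) (∉-⟷ q d∉Q) ∘ transversal⇒ (⟷-∷ d q))
        (λ d d∉P d∉Q → relabel-win p (⟷-∷ d q) (next (act d) (∉-⟷ p d∉P) (∉-⟷ q d∉Q)))

transposed : ∀ {n} → Symmetry n
transposed = record
  { act        = swap
  ; involutive = λ _ → refl
  ; preserves  = λ t → record
      { cell             = swap ∘ cell t
      ; distinct-rows    = distinct-columns t
      ; distinct-columns = distinct-rows t } , λ _ → refl }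

exchange : ∀ {n} (a a′ b b′ : Fin n) → Symmetry n
exchange a a′ b b′ = record
  { act        = act
  ; involutive = λ _ → cong₂ _,_ (transpose-involutive a a′ _) (transpose-involutive b b′ _)
  ; preserves  = λ t → record
      { cell             = act ∘ cell t
      ; distinct-rows    = distinct-rows t ∘ transpose-injective a a′
      ; distinct-columns = distinct-columns t ∘ transpose-injective b b′ } , λ _ → refl }
  where
  act : Cell _ → Cell _
  act (i , j) = transpose a a′ i , transpose b b′ j

-- Threats and the forced endgame.

graph-transversal : ∀ {n} (f : Fin n → Fin n) {L} → Injective _≡_ _≡_ f →
                    (∀ i → (i , f i) ∈ L) → TransversalIn L
graph-transversal f f-inj f∈ =
  record { cell = λ i → i , f i ; distinct-rows = id ; distinct-columns = f-inj } , f∈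

transversal-mono : ∀ {n} {K L : List (Cell n)} → (∀ {c} → c ∈ K → c ∈ L) →
                   TransversalIn K → TransversalIn L
transversal-mono K⊆L (t , t∈) = t , K⊆L ∘ t∈

-- A transversal meets `n` distinct rows, and all but that of `w` are listed in `L`. This bounds how
-- soon player 2 can finish.
transversal⇒≤ : ∀ {n} {w : Cell n} {O} {L : List (Fin n)} →
                   (∀ {c} → c ∈ O → proj₁ c ∈ L) → TransversalIn (w ∷ O) → n ≤ suc (length L)
transversal⇒≤ {w = w} {L = L} O⊆L (t , t∈) =
  injective-∈⇒≤ {xs = proj₁ w ∷ L} (distinct-rows t) (λ i → row∈ (t∈ i))
  where
  row∈ : ∀ {c} → c ∈ w ∷ _ → proj₁ c ∈ proj₁ w ∷ L
  row∈ (here refl) = here refl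
  row∈ (there c∈O) = there (O⊆L c∈O)

∉-∷ : ∀ {A : Set} {x y : A} {xs} → x ≢ y → x ∉ xs → x ∉ y ∷ xs
∉-∷ x≢y x∉ (here eq)   = x≢y eq
∉-∷ x≢y x∉ (there x∈) = x∉ x∈

-- Any answer other than `y` lets player 1 complete a transversal at `y`, so `next` is the only real
-- continuation.
force : ∀ {n} {P Q : List (Cell n)} y → y ∉ P → y ∉ Q → TransversalIn (y ∷ P) →
        (∀ d → d ∉ P → ¬ TransversalIn (d ∷ Q)) → Win P (y ∷ Q) → Won P Q
force {P = P} {Q} y y∉P y∉Q t safe next =
  reply (y , y∉P , y∉Q) (λ d d∉P _ → safe d d∉P) answer
  where
  answer : ∀ d → d ∉ P → d ∉ Q → Win P (d ∷ Q)
  answer d _ _ with y ≟ᶜ d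
  ... | yes refl = next
  ... | no y≢d   = move y y∉P (∉-∷ y≢d y∉Q) (done t)

AllBut : ∀ {n} → Fin n → List (Cell n) → Set
AllBut r P = (∀ i → i ≢ r → (i , i) ∈ P) ×
             (∀ {c} → c ∈ P → proj₁ c ≡ proj₂ c × proj₁ c ≢ r)

≢₁ : ∀ {n} {i i′ j j′ : Fin n} → i ≢ i′ → (i , j) ≢ (i′ , j′)
≢₁ i≢ = i≢ ∘ cong proj₁

≢₂ : ∀ {n} {i i′ j j′ : Fin n} → j ≢ j′ → (i , j) ≢ (i′ , j′)
≢₂ j≢ = j≢ ∘ cong proj₂

-- The threats (r , r) and (r , j) are forced, and then (r , k) creates a double
-- threat at (k , r) and (k , j).
endgame : ∀ {n} {r j k : Fin n} {P S} → AllBut r P → j ≢ r → k ≢ r → j ≢ k →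
          (r , r) ∉ S → (j , r) ∉ S → (r , j) ∉ S → (r , k) ∉ S → (k , r) ∉ S → (k , j) ∉ S →
          (∀ w → w ∉ P → ¬ TransversalIn (w ∷ (r , j) ∷ (r , r) ∷ S)) → Won P S
endgame {r = r} {j} {k} {P} {S} (diagonal , only) j≢r k≢r j≢k rr jr rj rk kr kj hopeless =
  force (r , r) (λ x → proj₂ (only x) refl) rr t₁ (λ d d∉ → hopeless d d∉ ∘ transversal-mono
    λ { (here eq) → here eq ; (there x) → there (there (there x)) })
  (move (j , r) (off j≢r) (∉-∷ (≢₁ j≢r) jr)
  (force (r , j) (∉-∷ (≢₂ j≢r) (off (j≢r ∘ sym))) (∉-∷ (≢₂ j≢r) rj) t₂
    (λ d d∉ → hopeless d (d∉ ∘ there) ∘ transversal-mono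
    λ { (here eq) → here eq ; (there x) → there (there x) })
  (move (r , k) (∉-∷ (≢₂ k≢r) (off (k≢r ∘ sym))) (∉-∷ (≢₂ (j≢k ∘ sym)) (∉-∷ (≢₂ k≢r) rk))
  (force (k , r) (∉-∷ (≢₁ k≢r) (∉-∷ (≢₁ (j≢k ∘ sym)) (off k≢r)))
    (∉-∷ (≢₁ k≢r) (∉-∷ (≢₁ k≢r) kr)) t₃ (λ d d∉ → hopeless d (d∉ ∘ there ∘ there))
  (move (k , j) (∉-∷ (≢₁ k≢r) (∉-∷ (≢₂ j≢r) (off (j≢k ∘ sym))))
    (∉-∷ (≢₂ j≢r) (∉-∷ (≢₁ k≢r) (∉-∷ (≢₁ k≢r) kj))) (done t₄))))))
  where
  off : ∀ {i i′} → i ≢ i′ → (i , i′) ∉ P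
  off i≢ = i≢ ∘ proj₁ ∘ only

  t₁ : TransversalIn ((r , r) ∷ P)
  t₁ = graph-transversal id id on
    where
    on : ∀ i → (i , i) ∈ (r , r) ∷ P
    on i with i ≟ r
    ... | yes refl = here refl
    ... | no i≢r   = there (diagonal i i≢r)

  t₂ : TransversalIn ((r , j) ∷ (j , r) ∷ P)
  t₂ = graph-transversal (transpose r j) (transpose-injective r j)
    (transpose-elim (λ i i′ → (i , i′) ∈ _) (here refl) (there (here refl))
      λ i i≢r _ → there (there (diagonal i i≢r)))

  t₃ : TransversalIn ((k , r) ∷ (r , k) ∷ (j , r) ∷ P)
  t₃ = graph-transversal (transpose r k) (transpose-injective r k)
    (transpose-elim (λ i i′ → (i , i′) ∈ _) (there (here refl)) (here refl)
      λ i i≢r _ → there (there (there (diagonal i i≢r))))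

  t₄ : TransversalIn ((k , j) ∷ (r , k) ∷ (j , r) ∷ P)
  -- The three-cycle sending `r` to `k`, `k` to `j` and `j` to `r`, as a product of two
  -- transpositions.
  t₄ = graph-transversal (transpose j k ∘ transpose r j)
    (transpose-injective r j ∘ transpose-injective j k)
    (transpose-elim (λ i i′ → (i , transpose j k i′) ∈ _)
      (there (here (cong (r ,_) (transpose-first j k))))
      (there (there (here (cong (j ,_) (transpose-other (j≢r ∘ sym) (k≢r ∘ sym))))))
      others)
    where
    others : ∀ i → i ≢ r → i ≢ j → (i , transpose j k i) ∈ (k , j) ∷ (r , k) ∷ (j , r) ∷ P
    others i i≢r i≢j with i ≟ k
    ... | yes refl = here (cong (k ,_) (transpose-second j k))
    ... | no i≢k   = there (there (there
      (subst (λ i′ → (i , i′) ∈ P) (sym (transpose-other i≢j i≢k)) (diagonal i i≢r))))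

-- (r , c) is the cell that player 2 is about to be forced to occupy: the bound on L
-- says that player 2 then needs two more rows, and s₀ is a mark that spoils none of
-- the cells (r , k), (k , r) of the endgame.
record Slack {n} (r c : Fin n) (S : List (Cell n)) : Set where
  field
    free    : (r , c) ∉ S
    S-short : suc (length S) < n
    L       : List (Fin n)
    L-short : suc (length L) < n
    r∈L     : r ∈ L
    rows∈L  : ∀ {d} → d ∈ S → proj₁ d ∈ L
    s₀      : Cell n
    rest    : List (Cell n)
    rest-short : suc (suc (length rest)) < n
    covers  : ∀ {d} → d ∈ S → d ∈ s₀ ∷ rest
    row≢    : proj₁ s₀ ≢ r
    column≢ : proj₂ s₀ ≢ c

-- Each mark spoils at most one candidate j outright; once j is chosen, s₀ spoils no k.
slack-endgame : ∀ {n} {r : Fin n} {P S} → AllBut r P → Slack r r S → Won P S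
slack-endgame {n} {r} {P} {S} allBut slack =
  endgame allBut j≢r k≢r j≢k free
    (j∉ ∘ there ∘ spoils-row) (j∉ ∘ there ∘ spoils-column j≢r)
    (k-row ∘ covers) (k-column ∘ covers) (j∉ ∘ there ∘ spoils-column j≢r)
    hopeless
  where
  open Slack slack

  -- A mark in column `r` can block only `(j , r)`; any other mark rules out its whole column as
  -- `j`. Hence `(k , j)` is free whatever `k` will be.
  spoils : Cell n → Fin n
  spoils (p , q) with q ≟ r
  ... | yes _ = p
  ... | no _  = q

  spoiled : List (Cell n) → List (Fin n)
  spoiled = map spoils

  spoils-column : ∀ {p q U} → q ≢ r → (p , q) ∈ U → q ∈ spoiled U
  spoils-column {p} {q} q≢r pq∈ = subst (_∈ _) eq (∈-map⁺ spoils pq∈)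
    where
    eq : spoils (p , q) ≡ q
    eq with q ≟ r
    ... | yes q≡r = contradiction q≡r q≢r
    ... | no _    = refl

  spoils-row : ∀ {p U} → (p , r) ∈ U → p ∈ spoiled U
  spoils-row {p} pr∈ = subst (_∈ _) eq (∈-map⁺ spoils pr∈)
    where
    eq : spoils (p , r) ≡ p
    eq with r ≟ r
    ... | yes _  = refl
    ... | no r≢r = contradiction refl r≢r

  j-found = ∃∉ (r ∷ spoiled S) (subst (λ l → suc l < n) (sym (length-map spoils S)) S-short)
  j  = proj₁ j-found
  j∉ = proj₂ j-found

  -- Leaving `s₀` out of `rest` pays for avoiding `j` as well as `r`.
  k-found = ∃∉ (r ∷ j ∷ spoiled rest)
    (subst (λ l → suc (suc l) < n) (sym (length-map spoils rest)) rest-short)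
  k  = proj₁ k-found
  k∉ = proj₂ k-found

  j≢r : j ≢ r
  j≢r = j∉ ∘ here

  k≢r : k ≢ r
  k≢r = k∉ ∘ here

  j≢k : j ≢ k
  j≢k = k∉ ∘ there ∘ here ∘ sym

  hopeless : ∀ w → w ∉ P → ¬ TransversalIn (w ∷ (r , j) ∷ (r , r) ∷ S)
  -- Both forced marks fall in row `r`, which `L` already counts.
  hopeless w _ t = ℕ.<⇒≱ L-short (transversal⇒≤
    (λ { (here refl) → r∈L ; (there (here refl)) → r∈L ; (there (there d∈S)) → rows∈L d∈S }) t)

  k-row : (r , k) ∉ s₀ ∷ rest
  k-row (here eq)   = row≢ (sym (cong proj₁ eq))
  k-row (there x)   = k∉ (there (there (spoils-column k≢r x)))

  k-column : (k , r) ∉ s₀ ∷ rest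
  k-column (here eq)   = column≢ (sym (cong proj₂ eq))
  k-column (there x)   = k∉ (there (there (spoils-row x)))

-- The two-by-two corner that remains at the end, its lines indexed by `Bool`.

line : ∀ {n} → Bool → Fin (2 + n)
line false = zero
line true  = suc zero

line-injective : ∀ {n u v} → line {n} u ≡ line v → u ≡ v
line-injective {u = false} {false} _ = refl
line-injective {u = true}  {true}  _ = refl
line-injective {u = false} {true}  ()
line-injective {u = true}  {false} ()

not-line : ∀ {n} u → line {n} (not u) ≢ line u
not-line u = not-¬ refl ∘ line-injective ∘ sym

line<2 : ∀ {n} u → toℕ (line {n} u) < 2
line<2 false = s≤s z≤n
line<2 true  = s≤s (s≤s z≤n)

data SameOrOther {n} (u : Bool) : Fin (2 + n) → Set where
  same   : SameOrOther u (line u)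
  other  : SameOrOther u (line (not u))
  beyond : ∀ {i} → 2 ≤ toℕ i → SameOrOther u i

sameOrOther : ∀ {n} u (i : Fin (2 + n)) → SameOrOther u i
sameOrOther false zero          = same
sameOrOther true  zero          = other
sameOrOther false (suc zero)    = other
sameOrOther true  (suc zero)    = same
sameOrOther u     (suc (suc i)) = beyond (s≤s (s≤s z≤n))

beyond-≢ : ∀ {n u} {i : Fin (2 + n)} → 2 ≤ toℕ i → i ≢ line u
beyond-≢ {u = u} 2≤i refl = ℕ.<⇒≱ (line<2 u) 2≤i

transpose-self : ∀ {n} (i k : Fin n) → transpose i i k ≡ k
transpose-self i = transpose-elim (λ k t → t ≡ k) refl refl (λ _ _ _ → refl)

-- The board still in play is the upper left square of side `m`; player 1 holds the rest of the
-- diagonal.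
From : ∀ {n} → ℕ → List (Cell n) → Set
From m P = (∀ i → m ≤ toℕ i → (i , i) ∈ P) ×
           (∀ {c} → c ∈ P → proj₁ c ≡ proj₂ c × m ≤ toℕ (proj₁ c))

from-∉ : ∀ {n m P} {i j : Fin n} → From m P → toℕ i < m → (i , j) ∉ P
from-∉ (_ , only) i<m c∈ = ℕ.<⇒≱ i<m (proj₂ (only c∈))

module _ {n : ℕ} (a a′ b b′ : Fin n) where
  open Symmetry (exchange a a′ b b′)
  open Relabelling (exchange a a′ b b′)

  -- The exchanged lines run through the remaining square, while player 1's marks lie on later rows
  -- and columns.
  from-⟷ : ∀ {m P} → From m P → toℕ a < m → toℕ a′ < m → toℕ b < m → toℕ b′ < m → P ⟷ P
  from-⟷ {m} {P} (_ , only) a< a′< b< b′< = fixed , fixed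
    where
    apart : ∀ {i j : Fin n} → m ≤ toℕ i → toℕ j < m → i ≢ j
    apart m≤i j<m refl = ℕ.<⇒≱ j<m m≤i

    fixed : ∀ {c} → c ∈ P → act c ∈ P
    fixed {i , j} c∈ with only c∈
    ... | refl , m≤i = subst (_∈ P) (sym (cong₂ _,_
      (transpose-other (apart m≤i a<) (apart m≤i a′<))
      (transpose-other (apart m≤i b<) (apart m≤i b′<)))) c∈

-- Player 1 takes the corner cell opposite to `(r , c)`. Exchanging columns `c` and `r` then brings
-- both cells onto the diagonal, where the endgame applies.
slack-win : ∀ {n} u v {P S} → From {2 + n} 2 P → (line (not u) , line (not v)) ∉ S →
            Slack (line u) (line v) S → Win P S
slack-win {n} u v {P} {S} from x∉S slack =
  move x (from-∉ from (line<2 (not u))) x∉S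
    (relabel-won (subst (λ y → (x ∷ P) ⟷ (y ∷ P)) act-x (⟷-∷ x
        (from-⟷ r r c r from (line<2 u) (line<2 u) (line<2 v) (line<2 u))))
      (map-⟷ S) (slack-endgame allBut slack′))
  where
  open Slack slack
  r = line u
  c = line v
  x = (line (not u) , line (not v))
  open Symmetry (exchange r r c r)
  open Relabelling (exchange r r c r)

  x′ : Cell (2 + n)
  x′ = (line (not u) , line (not u))

  other-column : ∀ u v → transpose (line {n} v) (line u) (line (not v)) ≡ line (not u)
  other-column false false = refl
  other-column false true  = refl
  other-column true  false = refl
  other-column true  true  = refl

  act-x : act x ≡ x′
  act-x = cong₂ _,_ (transpose-self r _) (other-column u v)

  allBut : AllBut r (x′ ∷ P)
  allBut = diagonal , λ { (here refl) → refl , not-line u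
                        ; (there c∈P) → proj₁ (proj₂ from c∈P) , beyond-≢ (proj₂ (proj₂ from c∈P)) }
    where
    diagonal : ∀ i → i ≢ r → (i , i) ∈ x′ ∷ P
    diagonal i i≢r with sameOrOther u i
    ... | same       = contradiction refl i≢r
    ... | other      = here refl
    ... | beyond 2≤i = there (proj₁ from i 2≤i)

  slack′ : Slack r r (map act S)
  slack′ = record
    { free    = subst (_∉ map act S) (cong₂ _,_ (transpose-self r r) (transpose-first c r))
                  (∉-⟷ (map-⟷ S) free)
    ; S-short = subst (λ l → suc l < _) (sym (length-map act S)) S-short
    ; L       = L
    ; L-short = L-short
    ; r∈L     = r∈L
    ; rows∈L  = λ d∈ → let e , e∈S , eq = ∈-map⁻ act d∈ in
        subst (_∈ L) (sym (trans (cong proj₁ eq) (transpose-self r _))) (rows∈L e∈S)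
    ; s₀      = act s₀
    ; rest    = map act rest
    ; rest-short = subst (λ l → suc (suc l) < _) (sym (length-map act rest)) rest-short
    ; covers  = λ d∈ → let e , e∈S , eq = ∈-map⁻ act d∈ in
        subst (_∈ _) (sym eq) (∈-map⁺ act (covers e∈S))
    ; row≢    = row≢ ∘ trans (sym (transpose-self r _))
    ; column≢ = λ eq → column≢ (transpose-injective c r (trans eq (sym (transpose-first c r))))
    }

-- Choosing the missing cell from the marks of player 2.

OffCorner : ∀ {n} → Cell (2 + n) → Set
OffCorner c = ∀ u v → c ≢ (line u , line v)

off-corner-column : ∀ {n u v} {c : Cell (2 + n)} → OffCorner c → proj₁ c ≡ line u → proj₂ c ≢ line v
off-corner-column {u = u} {v} off refl refl = off u v refl

off-corner-row : ∀ {n u v} {c : Cell (2 + n)} → OffCorner c → proj₂ c ≡ line v → proj₁ c ≢ line u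
off-corner-row {u = u} {v} off refl refl = off u v refl

off-corner? : ∀ {n} (c : Cell (2 + n)) → (∃[ u ] ∃[ v ] c ≡ (line u , line v)) ⊎ OffCorner c
off-corner? (i , j) with sameOrOther false i | sameOrOther false j
... | same       | same       = inj₁ (_ , _ , refl)
... | same       | other      = inj₁ (_ , _ , refl)
... | other      | same       = inj₁ (_ , _ , refl)
... | other      | other      = inj₁ (_ , _ , refl)
... | beyond 2≤i | _          = inj₂ λ u v → beyond-≢ 2≤i ∘ cong proj₁
... | _          | beyond 2≤j = inj₂ λ u v → beyond-≢ 2≤j ∘ cong proj₂

off-corner-swap : ∀ {n} {c : Cell (2 + n)} → OffCorner c → OffCorner (swap c)
off-corner-swap off u v refl = off v u refl

avoiding : ∀ {n} (i : Fin (2 + n)) → ∃[ v ] i ≢ line v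
avoiding i with sameOrOther false i
... | same       = true , λ ()
... | other      = false , λ ()
... | beyond 2≤i = false , beyond-≢ 2≤i

from-swap : ∀ {n m} {P : List (Cell n)} → From m P → (∀ {c} → c ∈ P → swap c ∈ P)
from-swap (_ , only) {i , j} c∈ with only c∈
... | refl , _ = c∈

from-transposed : ∀ {n m} {P : List (Cell n)} {Q} → From m P → Win P (map swap Q) → Win P Q
from-transposed {Q = Q} from = relabel-win (from-swap from , from-swap from) (map-⟷ Q)
  where open Relabelling transposed

module _ {k : ℕ} {P : List (Cell (4 + k))} (from : From 2 P) where

  rows : List (Cell (4 + k)) → List (Fin (4 + k))
  rows = map proj₁

  rows-short : ∀ S → length S ≡ 2 + k → suc (length (rows S)) < 4 + k
  rows-short S |S| = s≤s (s≤s (≤-reflexive (trans (length-map proj₁ S) |S|)))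

  -- Since `S` already meets row `line u`, the marks forced there open no new row, and the at most
  -- `n - 2` rows of `S` serve as `L`.
  used-row : ∀ u v {S s₀ rest} → (line u , line v) ∉ S → (line (not u) , line (not v)) ∉ S →
             length S ≡ 2 + k → length rest ≡ 1 + k → (∀ {d} → d ∈ S → d ∈ s₀ ∷ rest) →
             line u ∈ rows S → proj₁ s₀ ≢ line u → proj₂ s₀ ≢ line v → Win P S
  used-row u v {S} {s₀} {rest} y∉S x∉S |S| |rest| covers used row≢ column≢ =
    slack-win u v from x∉S record
      { free       = y∉S
      ; S-short    = s≤s (s≤s (≤-reflexive |S|))
      ; L          = rows S
      ; L-short    = rows-short S |S|
      ; r∈L        = used
      ; rows∈L     = ∈-map⁺ proj₁
      ; s₀         = s₀
      ; rest       = rest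
      ; rest-short = s≤s (s≤s (s≤s (≤-reflexive |rest|)))
      ; covers     = covers
      ; row≢       = row≢
      ; column≢    = column≢
      }

  ∈-exchange : ∀ {A : Set} {x y z : A} {xs} → x ∈ y ∷ z ∷ xs → x ∈ z ∷ y ∷ xs
  ∈-exchange (here eq)           = there (here eq)
  ∈-exchange (there (here eq))   = here eq
  ∈-exchange (there (there x∈)) = there (there x∈)

  -- The missing cell is put beside the mark in the corner, in the same row, and `q` plays the part
  -- of `s₀`.
  corner-row : ∀ u v {q Q} → length Q ≡ k → (∀ {c} → c ∈ q ∷ Q → OffCorner c) →
               proj₁ q ≢ line u → proj₂ q ≢ line (not v) →
               Win P ((line u , line v) ∷ q ∷ Q)
  corner-row u v |Q| off = used-row u (not v)
    (∉-∷ (≢₂ (not-line v)) λ c∈ → off c∈ _ _ refl)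
    (∉-∷ (≢₁ (not-line u)) λ c∈ → off c∈ _ _ refl)
    (cong (2 +_) |Q|) (cong suc |Q|) ∈-exchange (here refl)

  -- If `q` or `d` lies off row `line u`, it can be `s₀`, and the column of the missing cell is
  -- chosen to avoid it.
  row-used : ∀ u {d q Q} → length Q ≡ k → (∀ {c} → c ∈ d ∷ q ∷ Q → OffCorner c) →
             line u ∈ rows (d ∷ q ∷ Q) → Win P (d ∷ q ∷ Q)
  row-used u {d} {q} {Q} |Q| off used with proj₁ q ≟ line u | proj₁ d ≟ line u
  ... | no q≢  | _      = let v , column≢ = avoiding (proj₂ q) in
    used-row u v (λ c∈ → off c∈ _ _ refl) (λ c∈ → off c∈ _ _ refl)
      (cong (2 +_) |Q|) (cong suc |Q|) ∈-exchange used q≢ column≢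
  ... | yes _  | no d≢  = let v , column≢ = avoiding (proj₂ d) in
    used-row u v (λ c∈ → off c∈ _ _ refl) (λ c∈ → off c∈ _ _ refl)
      (cong (2 +_) |Q|) (cong suc |Q|) id used d≢ column≢
  -- Two marks share a row, so the missing cell goes into the other row of the corner: counting the
  -- shared row once leaves room in `L` for the new one.
  ... | yes q≡ | yes d≡ = slack-win (not u) false from (λ c∈ → off c∈ _ _ refl) record
      { free       = λ c∈ → off c∈ _ _ refl
      ; S-short    = s≤s (s≤s (≤-reflexive (cong (2 +_) |Q|)))
      ; L          = line (not u) ∷ rows (q ∷ Q)
      -- `q ∷ q ∷ Q` is merely a list of the same length as `L`.
      ; L-short    = rows-short (q ∷ q ∷ Q) (cong (2 +_) |Q|)
      ; r∈L        = here refl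
      ; rows∈L     = λ { (here refl) → there (here (trans d≡ (sym q≡)))
                       ; (there c∈) → there (∈-map⁺ proj₁ c∈) }
      ; s₀         = q
      ; rest       = d ∷ Q
      ; rest-short = s≤s (s≤s (s≤s (≤-reflexive (cong suc |Q|))))
      ; covers     = ∈-exchange
      ; row≢       = λ eq → not-line u (trans (sym eq) q≡)
      ; column≢    = off-corner-column (off (there (here refl))) q≡
      }

  -- Player 2 wastes no move here, but row 0 and column 0 remain empty of its marks
  -- and meet in a cell of player 1.
  untouched : ∀ {S} → length S ≡ 2 + k →
              (∀ u → line u ∉ rows S) → (∀ v → line v ∉ map proj₂ S) → Win P S
  untouched {S} |S| no-row no-column =
    move (zero , zero) (from-∉ from (s≤s z≤n)) (row∉ false)
      -- All six cells lie in rows 0 and 1 or column 1, hence are free, and the marks forced before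
      -- the double threat, `(1 , 1)` and `(1 , 2)`, avoid row 0 and column 0.
      (endgame {r = suc zero} {suc (suc zero)} {zero} allBut (λ ()) (λ ()) (λ ())
        (row∉ true) (column∉ true) (row∉ true) (row∉ true) (row∉ false) (row∉ false) hopeless)
    where
    row∉ : ∀ u {j} → (line u , j) ∉ S
    row∉ u c∈ = no-row u (∈-map⁺ proj₁ c∈)

    column∉ : ∀ v {i} → (i , line v) ∉ S
    column∉ v c∈ = no-column v (∈-map⁺ proj₂ c∈)

    allBut : AllBut (suc zero) ((zero , zero) ∷ P)
    allBut = (λ { zero _          → here refl
                ; (suc zero) 1≢1  → contradiction refl 1≢1
                ; (suc (suc i)) _ → there (proj₁ from _ (s≤s (s≤s z≤n))) })
           , (λ { (here refl) → refl , λ ()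
                ; (there c∈)  → proj₁ (proj₂ from c∈) , beyond-≢ {u = true} (proj₂ (proj₂ from c∈)) })

    hopeless : ∀ w → w ∉ (zero , zero) ∷ P →
               ¬ TransversalIn (w ∷ (suc zero , suc (suc zero)) ∷ (suc zero , suc zero) ∷ S)
    -- Row 0 and column 0 can each be met only by `w`, which would then be player 1's cell.
    hopeless w w∉ (t , t∈) = w∉ (here (cong₂ _,_ row column))
      where
      row : proj₁ w ≡ zero
      row with injective⇒hits (distinct-rows t) zero
      ... | i , eq with cell t i | t∈ i | eq
      ...   | _ | here refl               | refl = refl
      ...   | _ | there (here refl)       | ()
      ...   | _ | there (there (here refl)) | ()
      ...   | _ | there (there (there c∈)) | refl = contradiction c∈ (row∉ false)

      column : proj₂ w ≡ zero
      column with injective⇒hits (distinct-columns t) zero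
      ... | i , eq with cell t i | t∈ i | eq
      ...   | _ | here refl               | refl = refl
      ...   | _ | there (here refl)       | ()
      ...   | _ | there (there (here refl)) | ()
      ...   | _ | there (there (there c∈)) | refl = contradiction c∈ (column∉ false)

off-swapped : ∀ {n} {S : List (Cell (2 + n))} → (∀ {c} → c ∈ S → OffCorner c) →
              ∀ {c} → c ∈ map swap S → OffCorner c
off-swapped off c∈ with ∈-map⁻ swap c∈
... | d , d∈ , refl = off-corner-swap (off d∈)

line∈? : ∀ {n} (L : List (Fin (2 + n))) → (∃[ u ] line u ∈ L) ⊎ (∀ u → line u ∉ L)
line∈? L with DecMembership._∈?_ _≟_ (line false) L | DecMembership._∈?_ _≟_ (line true) L
... | yes 0∈ | _      = inj₁ (false , 0∈)
... | no _   | yes 1∈ = inj₁ (true , 1∈)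
... | no 0∉  | no 1∉  = inj₂ λ { false → 0∉ ; true → 1∉ }

final : ∀ {k P d q Q} → From {4 + k} 2 P → length Q ≡ k →
        (∀ {c} → c ∈ q ∷ Q → OffCorner c) → Win P (d ∷ q ∷ Q)
final {d = d} {q} {Q} from |Q| off with off-corner? d
... | inj₁ (u , v , refl) with proj₁ q ≟ line u | proj₂ q ≟ line (not v)
...   | no row≢ | no column≢ = corner-row from u v |Q| off row≢ column≢
-- Being off the corner, a `q` on a corner line of one direction misses both corner lines of the
-- other, so the transposed position meets the conditions.
...   | yes row≡ | _ = from-transposed from (corner-row from v u (trans (length-map swap Q) |Q|)
  (off-swapped off) (off-corner-column (off (here refl)) row≡)
  λ eq → not-line u (trans (sym eq) row≡))
...   | _ | yes column≡ = from-transposed from (corner-row from v u (trans (length-map swap Q) |Q|)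
  (off-swapped off) (λ eq → not-line v (trans (sym column≡) eq))
  (off-corner-row (off (here refl)) column≡))
final {d = d} {q} {Q} from |Q| off | inj₂ d-off
  with line∈? (map proj₁ (d ∷ q ∷ Q)) | line∈? (map proj₁ (map swap (d ∷ q ∷ Q)))
... | inj₁ (u , u∈) | _ = row-used from u |Q| (λ { (here refl) → d-off ; (there c∈) → off c∈ }) u∈
... | _ | inj₁ (v , v∈) = from-transposed from (row-used from v (trans (length-map swap Q) |Q|)
  (off-swapped λ { (here refl) → d-off ; (there c∈) → off c∈ }) v∈)
... | inj₂ no-row | inj₂ no-column = untouched from (cong (2 +_) |Q|) no-row
  λ v → no-column v ∘ subst (line v ∈_) (map-∘ (d ∷ q ∷ Q))

-- Shrinking the board to the last corner.

Outside : ∀ {n} → ℕ → List (Cell n) → Set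
Outside m Q = ∀ {c} → c ∈ Q → toℕ (proj₁ c) < m → ¬ toℕ (proj₂ c) < m

-- Exchanging row `a` and column `b` with the last lines of the square puts the new mark on the
-- diagonal; the row that leaves the square takes with it every mark of player 2 inside.
shrink : ∀ {n m} {P Q : List (Cell n)} (a b : Fin n) → From (suc m) P →
       toℕ a < suc m → toℕ b < suc m → (a , b) ∉ Q → m < n →
       (∀ {c} → c ∈ Q → toℕ (proj₁ c) < suc m → toℕ (proj₂ c) < suc m → proj₁ c ≡ a) →
       (∀ {P′ Q′} → From m P′ → Outside m Q′ →
         length Q′ ≡ length Q → Won P′ Q′) →
       Win P Q
shrink {n} {m} {P} {Q} a b from a< b< ab∉Q m<n in-row-a descend =
  move (a , b) (from-∉ from a<) ab∉Q
    (relabel-won (subst (λ y → ((a , b) ∷ P) ⟷ (y ∷ P)) act-ab (⟷-∷ (a , b)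
        (from-⟷ a t b t from a< t< b< t<)))
      (map-⟷ Q) (descend from′ off (length-map act Q)))
  where
  t : Fin n
  t = fromℕ< m<n

  t≡m : toℕ t ≡ m
  t≡m = toℕ-fromℕ< m<n

  t< : toℕ t < suc m
  t< = s≤s (≤-reflexive t≡m)

  open Symmetry (exchange a t b t)
  open Relabelling (exchange a t b t)

  act-ab : act (a , b) ≡ (t , t)
  act-ab = cong₂ _,_ (transpose-first a t) (transpose-first b t)

  from′ : From m ((t , t) ∷ P)
  from′ = diagonal , λ { (here refl) → refl , ≤-reflexive (sym t≡m)
                       ; (there c∈)  → let eq , m< = proj₂ from c∈ in eq , ℕ.<⇒≤ m< }
    where
    diagonal : ∀ i → m ≤ toℕ i → (i , i) ∈ (t , t) ∷ P
    diagonal i m≤i with i ≟ t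
    ... | yes refl = here refl
    ... | no i≢t   = there (proj₁ from i
      (ℕ.≤∧≢⇒< m≤i λ m≡i → i≢t (toℕ-injective (trans (sym m≡i) (sym t≡m)))))

  before : ∀ (x : Fin n) → toℕ x < suc m → ∀ i → toℕ (transpose x t i) < m → i ≢ x × toℕ i < suc m
  before x x< = transpose-elim (λ i i′ → toℕ i′ < m → i ≢ x × toℕ i < suc m)
    (λ t<m → contradiction (subst (_< m) t≡m t<m) (n≮n m))
    (λ x<m → (λ t≡x → n≮n m (subst (_< m) (trans (cong toℕ (sym t≡x)) t≡m) x<m)) , t<)
    (λ i i≢x i≢t i<m → i≢x , ℕ.<-trans i<m ≤-refl)

  off : Outside m (map act Q)
  off c∈ row< column< with ∈-map⁻ act c∈
  ... | (i , j) , ij∈Q , refl with before a a< i row< | before b b< j column<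
  ...   | i≢a , i< | _ , j< = i≢a (in-row-a ij∈Q i< j<)

mutual
  -- `size` keeps player 2 one mark behind the `n - (2 + j)` marks of player 1; with so few marks no
  -- single move can finish.
  stage : ∀ {k} j {P Q} → From {4 + k} (2 + j) P → Outside (2 + j) Q →
          length Q + (3 + j) ≡ 4 + k → Won P Q
  stage {k} j {P} {Q} from off size = reply
    ((zero , zero) , from-∉ from (s≤s z≤n) , λ c∈ → off c∈ (s≤s z≤n) (s≤s z≤n))
    (λ d _ _ t → ℕ.<⇒≱ short (transversal⇒≤ (∈-map⁺ proj₁) t))
    (λ d _ _ → respond j d from off size)
    where
    short : suc (length (map proj₁ Q)) < 4 + k
    short = subst₂ (λ l n → suc l < n) (sym (length-map proj₁ Q))
      (trans (ℕ.+-comm (3 + j) (length Q)) size) (s≤s (s≤s (ℕ.m≤n+m (length Q) (suc j))))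

  respond : ∀ {k} j {P Q} d → From {4 + k} (2 + j) P → Outside (2 + j) Q →
            length Q + (3 + j) ≡ 4 + k → Win P (d ∷ Q)
  -- As `n` is at least 4, player 2 has an earlier mark `q` besides `d`.
  respond zero {Q = []} d from off ()
  respond {k} zero {Q = q ∷ Q} d from off size = final from
    (ℕ.+-cancelʳ-≡ 3 (length Q) k (trans (ℕ.suc-injective size) (ℕ.+-comm 3 k)))
    λ { c∈ u v refl → off c∈ (line<2 u) (line<2 v) }
  respond {k} (suc j) {P} {Q} d from off size
    with toℕ (proj₁ d) ℕ.<? 3 + j | toℕ (proj₂ d) ℕ.<? 3 + j
  -- Any column but that of `d` gives a free cell of its row; two candidates suffice.
  ... | yes row< | yes column< = let v , d≢ = avoiding (proj₂ d) in
    shrink (proj₁ d) (line v) from row< (v< v) (∉-∷ (≢₂ (d≢ ∘ sym)) λ c∈ → off c∈ row< (v< v))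
      (shrink-size size) (λ { (here refl) _ _ → refl ; (there c∈) r< c< → contradiction c< (off c∈ r<) })
      (descend size)
    where
    v< : ∀ v → toℕ (line {2 + k} v) < 3 + j
    v< v = ≤-trans (line<2 v) (s≤s (s≤s z≤n))
  -- `d` lies outside the square, which is still empty of player 2's marks, so a fixed cell will do.
  ... | no row≮ | _ = shrink zero zero from (s≤s z≤n) (s≤s z≤n)
    (∉-∷ (λ { refl → row≮ (s≤s z≤n) }) λ c∈ → off c∈ (s≤s z≤n) (s≤s z≤n)) (shrink-size size)
    (λ { (here refl) r< _ → contradiction r< row≮
       ; (there c∈) r< c< → contradiction c< (off c∈ r<) })
    (descend size)
  ... | _ | no column≮ = shrink zero zero from (s≤s z≤n) (s≤s z≤n)
    (∉-∷ (λ { refl → column≮ (s≤s z≤n) }) λ c∈ → off c∈ (s≤s z≤n) (s≤s z≤n)) (shrink-size size)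
    (λ { (here refl) _ c< → contradiction c< column≮
       ; (there c∈) r< c< → contradiction c< (off c∈ r<) })
    (descend size)

  shrink-size : ∀ {j k q} → q + (4 + j) ≡ 4 + k → 2 + j < 4 + k
  shrink-size {j} {k} {q} size =
    ≤-trans (ℕ.n≤1+n (3 + j)) (subst (4 + j ≤_) size (ℕ.m≤n+m (4 + j) q))

  descend : ∀ {j k q} → q + (4 + j) ≡ 4 + k → ∀ {P′ Q′} → From {4 + k} (2 + j) P′ →
              Outside (2 + j) Q′ → length Q′ ≡ suc q → Won P′ Q′
  descend {j} {q = q} size from off |Q| = stage j from off
    (trans (cong (_+ (3 + j)) |Q|) (trans (sym (ℕ.+-suc q (3 + j))) size))

-- The first mark is itself a shrinking step, from the whole board, where `From` holds vacuously.
opening : ∀ k → Win {4 + k} [] []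
opening k = shrink zero zero ((λ i n≤i → contradiction n≤i (ℕ.<⇒≱ (toℕ<n i))) , λ ())
  (s≤s z≤n) (s≤s z≤n) (λ ()) ≤-refl (λ ())
  λ from off |Q| → stage (1 + k) from off (cong (_+ (4 + k)) |Q|)

theorem1 : (n : ℕ) → n ≥ 4 → Σ[ σ ∈ Strategy n ] IsWinningForPlayer₁ σ
theorem1 (suc (suc (suc (suc k)))) (s≤s (s≤s (s≤s (s≤s z≤n)))) =
  FromWin.σ (opening k) , FromWin.wins (opening k) zero
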